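{- Let $\phi(x) = x^d + c$, where $c,d \in \mathbb{Z}$ and $d \ge 2$, and let $S_{d,c}$ be the set of primes $p$ such that the map induced by $\phi$ on $\mathbb{Z}/p\mathbb{Z}$ consists of a single $p$-cycle. If $d$ is even and $c$ is odd, then $S_{d,c} = \{2\}$. If $d$ is even and $c$ is even, then $S_{d,c} = \emptyset$.
   Context: For a prime $p$, the polynomial $\phi \in \mathbb{Z}[x]$ induces a map $\phi: \mathbb{Z}/p\mathbb{Z} \to \mathbb{Z}/p\mathbb{Z}$. "Consists of a single $p$-cycle" means that this map is a permutation of the $p$ elements of $\mathbb{Z}/p\mathbb{Z}$ that is a cycle of length $p$ (equivalently, $0$ is periodic with exact period $p$ modulo $p$). -}

module Defs where

open import Data.Fin.Base using (Fin; toℕ; fromℕ<)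
open import Data.Integer.Base using (ℤ; +_; _+_; _^_)
open import Data.Integer.DivMod using (_%ℕ_; n%ℕd<d)
open import Data.Nat.Base using (ℕ; suc; NonZero)
open import Data.Nat.DivMod using (_mod_)
open import Data.Nat.Primality using (Prime; prime⇒nonZero)
open import Data.Product.Base using (Σ; ∃-syntax; _×_)
open import Function.Definitions using (Injective; Bijective)
open import Level using (Level; 0ℓ)
open import Relation.Binary.PropositionalEquality.Core using (_≡_; _≢_)
open import Relation.Unary using (Pred)

private
  variable
    a : Level

φ : ℕ → ℤ → ℤ → ℤ
φ d c x = x ^ d + c

-- ℤ/nℤ is represented by Fin n, the class of an integer being its least
-- non-negative residue.
residue : (n : ℕ) .{{_ : NonZero n}} → ℤ → Fin n
residue n x = fromℕ< (n%ℕd<d x n)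

-- Evaluating at the representative in {0, …, n-1} loses nothing, since a
-- polynomial with integer coefficients respects congruence modulo n.
inducedMap : (d : ℕ) (c : ℤ) (n : ℕ) .{{_ : NonZero n}} → Fin n → Fin n
inducedMap d c n x = residue n (φ d c (+ toℕ x))

-- f is the cycle (s 0  s 1  …  s (k-1)): the entries are distinct, f moves
-- each entry to the next (indices modulo k) and fixes everything else.
IsCycleOfLength : {A : Set a} (k : ℕ) .{{_ : NonZero k}} → (A → A) → Set a
IsCycleOfLength {A = A} k f =
  Bijective _≡_ _≡_ f ×
  (∃[ s ] Injective {A = Fin k} {B = A} _≡_ _≡_ s
        × (∀ i → f (s i) ≡ s (suc (toℕ i) mod k))
        × (∀ x → (∀ i → s i ≢ x) → f x ≡ x))

S : ℕ → ℤ → Pred ℕ 0ℓ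
S d c p = Σ (Prime p) λ isPrime →
  let instance p≢0 : NonZero p
               p≢0 = prime⇒nonZero isPrime
  in IsCycleOfLength p (inducedMap d c p)

{-# OPTIONS --safe #-}
-- For even d we have φ(-1) = φ(1), and 1 ≠ -1 modulo every prime p > 2, so the
-- induced map is not injective unless p = 2.  Modulo 2 it is x ↦ x + c: the
-- transposition when c is odd, the identity when c is even.
module Submission where

open import Defs
open import Data.Empty using (⊥-elim)
open import Data.Fin.Base using (Fin; zero; suc; toℕ; fromℕ)
open import Data.Fin.Properties using (fromℕ<-cong; toℕ-fromℕ)
open import Data.Integer.Base using (ℤ; +_; 0ℤ; 1ℤ; _+_; _-_; _⊖_; _*_; _^_; ∣_∣)
open import Data.Integer.DivMod using (_%ℕ_; _/ℕ_; n%ℕd<d; a≡a%ℕn+[a/ℕn]*n)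
open import Data.Integer.Divisibility.Signed as Signed using (_∣_; divides; ∣ᵤ⇒∣; ∣⇒∣ᵤ)
open import Data.Integer.Properties
  using (^-zeroˡ; ^-*-assoc; [+m]-[+n]≡m⊖n; ∣⊖∣-≤; ∣m⊖n∣≡∣n⊖m∣; +-identityˡ; +-identityʳ)
open import Data.Integer.Tactic.RingSolver using (solve-∀)
open import Data.Nat.Base as ℕ using (ℕ; zero; suc; _≤_; _<_; NonZero; s≤s)
open import Data.Nat.DivMod using (_mod_)
import Data.Nat.Properties as ℕ
open import Data.Nat.Primality using (prime; prime[2])
open import Data.Product.Base using (_×_; _,_)
open import Data.Sum.Base using (_⊎_; inj₁; inj₂)
open import Function.Definitions using (Injective)
open import Relation.Binary.PropositionalEquality
  using (_≡_; _≢_; refl; sym; trans; cong; cong₂; subst; subst₂; module ≡-Reasoning)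
open import Relation.Nullary.Negation.Core using (¬_; contradiction)
open import Relation.Unary using (_≐_; ｛_｝; ∅)
import Data.Integer.Divisibility as ℤ
import Data.Nat.Divisibility as ℕ

∣∧<⇒≡0 : ∀ {m n} → m ℕ.∣ n → n < m → n ≡ 0
∣∧<⇒≡0 {n = zero}  _   _   = refl
∣∧<⇒≡0 {n = suc _} m∣n n<m = contradiction m∣n (ℕ.>⇒∤ n<m)

∣[m-n]∣≡∣m-n∣ : ∀ m n → ∣ + m - + n ∣ ≡ ℕ.∣ m - n ∣
∣[m-n]∣≡∣m-n∣ m n = trans (cong ∣_∣ ([+m]-[+n]≡m⊖n m n)) (∣⊖∣ (ℕ.≤-total m n))
  where
  ∣⊖∣ : m ≤ n ⊎ n ≤ m → ∣ m ⊖ n ∣ ≡ ℕ.∣ m - n ∣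
  ∣⊖∣ (inj₁ m≤n) = trans (∣⊖∣-≤ m≤n) (sym (ℕ.m≤n⇒∣m-n∣≡n∸m m≤n))
  ∣⊖∣ (inj₂ n≤m) = trans (∣m⊖n∣≡∣n⊖m∣ m n)
    (trans (∣⊖∣-≤ n≤m) (sym (ℕ.m≤n⇒∣n-m∣≡n∸m n≤m)))

-- The two remainders differ by a multiple of `n`. Both lie in [0, n), so their distance is less
-- than `n` and must vanish.
∣-⇒%ℕ≡ : ∀ n .{{_ : NonZero n}} x y → + n ∣ x - y → x %ℕ n ≡ y %ℕ n
∣-⇒%ℕ≡ n x y (divides q x-y≡qn) = ℕ.∣m-n∣≡0⇒m≡n (∣∧<⇒≡0 n∣diff diff<n)
  where
  open ≡-Reasoning
  r = x %ℕ n
  s = y %ℕ n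

  regroup : ∀ r s u v n → r - s ≡ ((r + u * n) - (s + v * n)) + (v - u) * n
  regroup = solve-∀

  collect : ∀ q u v n → q * n + (v - u) * n ≡ (q + (v - u)) * n
  collect = solve-∀

  r-s≡ : + r - + s ≡ (q + (y /ℕ n - x /ℕ n)) * + n
  r-s≡ = begin
    + r - + s
      ≡⟨ regroup (+ r) (+ s) (x /ℕ n) (y /ℕ n) (+ n) ⟩
    ((+ r + x /ℕ n * + n) - (+ s + y /ℕ n * + n)) + (y /ℕ n - x /ℕ n) * + n
      ≡⟨ cong₂ (λ a b → (a - b) + (y /ℕ n - x /ℕ n) * + n)
           (a≡a%ℕn+[a/ℕn]*n x n) (a≡a%ℕn+[a/ℕn]*n y n) ⟨
    (x - y) + (y /ℕ n - x /ℕ n) * + n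
      ≡⟨ cong (_+ (y /ℕ n - x /ℕ n) * + n) x-y≡qn ⟩
    q * + n + (y /ℕ n - x /ℕ n) * + n
      ≡⟨ collect q (x /ℕ n) (y /ℕ n) (+ n) ⟩
    (q + (y /ℕ n - x /ℕ n)) * + n ∎

  n∣diff : n ℕ.∣ ℕ.∣ r - s ∣
  n∣diff = subst (n ℕ.∣_) (∣[m-n]∣≡∣m-n∣ r s)
    (∣⇒∣ᵤ {+ n} {+ r - + s} (divides (q + (y /ℕ n - x /ℕ n)) r-s≡))

  diff<n : ℕ.∣ r - s ∣ < n
  diff<n = ℕ.≤-<-trans (ℕ.∣m-n∣≤m⊔n r s) (ℕ.⊔-lub (n%ℕd<d x n) (n%ℕd<d y n))

residue-cong : ∀ n .{{_ : NonZero n}} x y → + n ∣ x - y → residue n x ≡ residue n y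
residue-cong n x y n∣x-y =
  fromℕ<-cong _ _ (∣-⇒%ℕ≡ n x y n∣x-y) (n%ℕd<d x n) (n%ℕd<d y n)

x-y∣x^n-y^n : ∀ x y n → x - y ∣ x ^ n - y ^ n
x-y∣x^n-y^n x y zero    = divides 0ℤ refl
x-y∣x^n-y^n x y (suc n) = subst (x - y ∣_) (sym (split x y (x ^ n) (y ^ n)))
  (Signed.∣m∣n⇒∣m+n (Signed.∣n⇒∣m*n x (x-y∣x^n-y^n x y n))
                    (Signed.∣m⇒∣m*n (y ^ n) Signed.∣-refl))
  where
  split : ∀ x y a b → x * a - y * b ≡ x * (a - b) + (x - y) * b
  split = solve-∀

-- Write d = 2k. Then x + y divides x² - y², which divides (x²)^k - (y²)^k = x^d - y^d.
x+y∣x^d-y^d : ∀ x y {d} → 2 ℕ.∣ d → x + y ∣ x ^ d - y ^ d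
x+y∣x^d-y^d x y {d} (ℕ.divides k d≡k*2) =
  Signed.∣-trans (divides (x - y) (squares x y))
    (subst (x ^ 2 - y ^ 2 ∣_) (cong₂ _-_ (powers x) (powers y))
      (x-y∣x^n-y^n (x ^ 2) (y ^ 2) k))
  where
  -- `x * (x * 1ℤ)` is what `x ^ 2` unfolds to.
  squares : ∀ x y → x * (x * 1ℤ) - y * (y * 1ℤ) ≡ (x - y) * (x + y)
  squares = solve-∀

  powers : ∀ z → (z ^ 2) ^ k ≡ z ^ d
  powers z = trans (^-*-assoc z 2 k)
    (cong (z ^_) (trans (ℕ.*-comm 2 k) (sym d≡k*2)))

-- The last hypothesis makes `y` the representative of -x, so this is φ(-x) = φ(x): modulo `n`, the
-- sum x + y vanishes and it divides x^d - y^d, while `c` cancels.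
inducedMap-sym : ∀ {d} c n .{{_ : NonZero n}} → 2 ℕ.∣ d → (x y : Fin n) →
  + n ≡ + toℕ x + + toℕ y → inducedMap d c n x ≡ inducedMap d c n y
inducedMap-sym {d} c n 2∣d x y n≡x+y = residue-cong n (φ d c (+ toℕ x)) (φ d c (+ toℕ y))
  (subst₂ _∣_ (sym n≡x+y) (sym (cancel ((+ toℕ x) ^ d) ((+ toℕ y) ^ d) c))
    (x+y∣x^d-y^d (+ toℕ x) (+ toℕ y) 2∣d))
  where
  cancel : ∀ a b c → (a + c) - (b + c) ≡ a - b
  cancel = solve-∀

inducedMap-notInjective : ∀ {d} c m → 2 ℕ.∣ d →
  ¬ Injective _≡_ _≡_ (inducedMap d c (3 ℕ.+ m))
inducedMap-notInjective {d} c m 2∣d inj = one≢minusOne (inj {one} {minusOne} φ1≡φ⟨-1⟩)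
  where
  one minusOne : Fin (3 ℕ.+ m)
  one      = suc zero
  -- The largest element n - 1 stands for -1; for a modulus of the form 3 + m it is at least 2,
  -- hence visibly different from 1.
  minusOne = fromℕ (2 ℕ.+ m)

  one≢minusOne : one ≢ minusOne
  one≢minusOne ()

  φ1≡φ⟨-1⟩ : inducedMap d c (3 ℕ.+ m) one ≡ inducedMap d c (3 ℕ.+ m) minusOne
  φ1≡φ⟨-1⟩ = inducedMap-sym {d} c (3 ℕ.+ m) 2∣d one minusOne
    (cong (λ k → + suc k) (sym (toℕ-fromℕ (2 ℕ.+ m))))

S⊆｛2｝ : ∀ {d p} c → 2 ℕ.∣ d → S d c p → 2 ≡ p
-- A primality proof carries an instance of nontriviality, which is empty at 0 and at 1.
S⊆｛2｝ {p = 0} c 2∣d (prime {{()}} _ , _)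
S⊆｛2｝ {p = 1} c 2∣d (prime {{()}} _ , _)
S⊆｛2｝ {p = 2} c 2∣d _ = refl
S⊆｛2｝ {p = suc (suc (suc m))} c 2∣d (_ , (inj , _) , _) =
  ⊥-elim (inducedMap-notInjective c m 2∣d inj)

inducedMap-zero : ∀ {d} c → 2 ≤ d → inducedMap d c 2 zero ≡ residue 2 c
inducedMap-zero c (s≤s _) = cong (residue 2) (+-identityˡ c)

inducedMap-one : ∀ d c → inducedMap d c 2 (suc zero) ≡ residue 2 (1ℤ + c)
inducedMap-one d c = cong (λ z → residue 2 (z + c)) (^-zeroˡ d)

even⇒residue≡0 : ∀ c → + 2 ∣ c → residue 2 c ≡ zero
even⇒residue≡0 c 2∣c =
  residue-cong 2 c 0ℤ (subst (+ 2 ∣_) (sym (+-identityʳ c)) 2∣c)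

odd⇒2∣1+ : ∀ c → ¬ (+ 2 ∣ c) → + 2 ∣ 1ℤ + c
odd⇒2∣1+ c 2∤c with c %ℕ 2 | n%ℕd<d c 2 | a≡a%ℕn+[a/ℕn]*n c 2
... | 0 | _ | c≡ = contradiction (divides (c /ℕ 2) (trans c≡ (+-identityˡ _))) 2∤c
... | 1 | _ | c≡ = divides (1ℤ + c /ℕ 2) (trans (cong (_+_ 1ℤ) c≡) (carry (c /ℕ 2)))
  where
  carry : ∀ q → 1ℤ + (1ℤ + q * + 2) ≡ (1ℤ + q) * + 2
  carry = solve-∀
... | suc (suc _) | s≤s (s≤s ()) | _

odd⇒residue≡1 : ∀ c → + 2 ∣ 1ℤ + c → residue 2 c ≡ suc zero
odd⇒residue≡1 c 2∣1+c = residue-cong 2 c 1ℤ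
  (subst (+ 2 ∣_) (shift c) (Signed.∣m∣n⇒∣m-n 2∣1+c Signed.∣-refl))
  where
  shift : ∀ c → (1ℤ + c) - + 2 ≡ c - 1ℤ
  shift = solve-∀

swap-isCycle : (f : Fin 2 → Fin 2) → f zero ≡ suc zero → f (suc zero) ≡ zero →
  IsCycleOfLength 2 f
swap-isCycle f f0≡1 f1≡0 =
    (injective , λ y → f y , λ { refl → involutive y })
  , (λ i → i) , (λ eq → eq) , step , λ x x∉ → contradiction refl (x∉ x)
  where
  involutive : ∀ x → f (f x) ≡ x
  involutive zero       = trans (cong f f0≡1) f1≡0
  involutive (suc zero) = trans (cong f f1≡0) f0≡1

  injective : Injective _≡_ _≡_ f
  injective {x} {y} eq = trans (sym (involutive x)) (trans (cong f eq) (involutive y))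

  step : ∀ i → f i ≡ suc (toℕ i) mod 2
  step zero       = f0≡1
  step (suc zero) = f1≡0

fixesZero⇒notCycle : (f : Fin 2 → Fin 2) → f zero ≡ zero → ¬ IsCycleOfLength 2 f
fixesZero⇒notCycle f f0≡0 (_ , s , s-inj , step , _)
  with s zero in s0 | s (suc zero) in s1 | step zero | step (suc zero)
... | zero     | _        | f0≡s1 | _ with () ← s-inj (trans s0 (trans (sym f0≡0) (trans f0≡s1 (sym s1))))
... | suc zero | zero     | _ | f0≡1 with () ← trans (sym f0≡0) f0≡1
... | suc zero | suc zero | _ | _    with () ← s-inj (trans s0 (sym s1))

theorem1p1 : (d : ℕ) (c : ℤ) → 2 ≤ d →
    (2 ℕ.∣ d → ¬ (+ 2 ℤ.∣ c) → S d c ≐ ｛ 2 ｝) ×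
    (2 ℕ.∣ d → + 2 ℤ.∣ c → S d c ≐ ∅)
theorem1p1 d c 2≤d = odd , even
  where
  odd : 2 ℕ.∣ d → ¬ (+ 2 ℤ.∣ c) → S d c ≐ ｛ 2 ｝
  odd 2∣d 2∤c = S⊆｛2｝ c 2∣d , λ { refl → prime[2] , swap-isCycle _ f0≡1 f1≡0 }
    where
    2∣1+c : + 2 ∣ 1ℤ + c
    2∣1+c = odd⇒2∣1+ c (λ 2∣c → 2∤c (∣⇒∣ᵤ 2∣c))
    f0≡1 = trans (inducedMap-zero c 2≤d) (odd⇒residue≡1 c 2∣1+c)
    f1≡0 = trans (inducedMap-one d c) (even⇒residue≡0 (1ℤ + c) 2∣1+c)

  even : 2 ℕ.∣ d → + 2 ℤ.∣ c → S d c ≐ ∅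
  even 2∣d 2∣c = (λ p∈S → notIn p∈S (S⊆｛2｝ c 2∣d p∈S)) , λ ()
    where
    notIn : ∀ {p} → S d c p → ¬ (2 ≡ p)
    notIn (_ , cycle) refl = fixesZero⇒notCycle _
      (trans (inducedMap-zero c 2≤d) (even⇒residue≡0 c (∣ᵤ⇒∣ 2∣c))) cycle
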